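{- Let $0<p<1$ be a constant. For positive integers $n,m$, let $G_{n,m}$ be the random bipartite graph on the vertex set $V_1\cup V_2$ with $V_1\cap V_2=\emptyset$, $|V_1|=n$, $|V_2|=m$, in which each pair $\{i,k\}$ with $i\in V_1$, $k\in V_2$ is an edge independently with probability $p$, and there are no other edges. Suppose $n\in\Theta(m)$, i.e. there are constants $a,b>0$ with $n\le a m$ and $m\le b n$ for all sufficiently large $n,m$. Then $\Pr(G_{n,m}\text{ is a UNN})\to 1$ as $n+m\to\infty$.
   Context: All graphs are finite, simple and undirected. For a vertex $v$ of a graph, $\mathrm{nb}(v)$ denotes the set of its neighbors; a vertex is not its own neighbor. A graph $G=(V,E)$ is a unique-neighborhood network (UNN) if distinct vertices have distinct neighborhoods, i.e. $\mathrm{nb}(u)\neq\mathrm{nb}(v)$ (equivalently $\mathrm{nb}(u)\triangle\mathrm{nb}(v)\neq\emptyset$) for all distinct $u,v\in V$. -}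

module Defs where

open import Data.Bool using (Bool; true; false; T; if_then_else_)
open import Data.Bool.Properties using (T?)
open import Data.Empty using (⊥)
open import Data.Fin using (Fin)
open import Data.Fin.Properties using (+↔⊎; all?)
import Data.Fin.Properties as Fin
import Data.Integer as ℤ
open import Data.List using (List; []; _∷_; map; foldr; filter; cartesianProductWith)
open import Data.Nat using (ℕ; zero; suc; _⊔_)
import Data.Nat as ℕ
import Data.Nat.Properties as ℕ
open import Data.Product using (∃-syntax; _×_; _,_)
open import Data.Rational using (ℚ; 0ℚ; 1ℚ; ½; _+_; _-_; -_; _*_; ∣_∣; _<_; _≤_; _/_; 1/_; Positive; positive; NonZero)
import Data.Rational.Properties as ℚ
open import Data.Rational.Solver using (module +-*-Solver)
open import Data.Sum using (_⊎_; inj₁; inj₂)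
open import Data.Vec using (Vec; []; _∷_; lookup)
import Data.Vec as Vec
open import Function.Base using (id)
open import Function.Bundles using (_↔_; Inverse)
open import Function.Properties.Inverse using (↔-sym; Inverse⇒Injection)
open import Level using (0ℓ)
open import Relation.Binary.Core using (Rel)
open import Relation.Binary.Definitions using (Decidable; DecidableEquality; Symmetric; Irreflexive)
open import Relation.Binary.PropositionalEquality using (_≡_; _≢_; refl; sym; trans; cong; cong₂; subst)
open import Relation.Nullary.Decidable using (Dec; yes; no; map′; ¬?; _×-dec_; _→-dec_; via-injection)
open import Relation.Nullary.Negation using (¬_)
import Relation.Unary as U
open U using (Pred; _≐_)

------------------------------------------------------------------------
-- Real numbers as Cauchy sequences of rationals. The arithmetic operations
-- act termwise.

IsCauchy : (ℕ → ℚ) → Set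
IsCauchy s = ∀ ε → 0ℚ < ε → ∃[ N ] (∀ i j → N ℕ.≤ i → N ℕ.≤ j → ∣ s i - s j ∣ < ε)

record ℝ : Set where
  constructor mkℝ
  field
    seq    : ℕ → ℚ
    cauchy : IsCauchy seq

open ℝ public

-- No equality on ℝ is defined here: the intended one, x ≤ᵣ y × y ≤ᵣ x, is
-- coarser than _≡_, and both orders respect it.

infix 4 _<ᵣ_ _≤ᵣ_

_<ᵣ_ : ℝ → ℝ → Set
x <ᵣ y = ∃[ δ ] ∃[ N ] (0ℚ < δ × (∀ i → N ℕ.≤ i → seq x i + δ ≤ seq y i))

_≤ᵣ_ : ℝ → ℝ → Set
x ≤ᵣ y = ∀ ε → 0ℚ < ε → ∃[ N ] (∀ i → N ℕ.≤ i → seq x i ≤ seq y i + ε)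

private
  half-pos : ∀ {ε} → 0ℚ < ε → 0ℚ < ½ * ε
  half-pos {ε} 0<ε =
    subst (_< ½ * ε) (ℚ.*-zeroʳ ½) (ℚ.*-monoʳ-<-pos ½ 0<ε)

  halves : ∀ ε → ½ * ε + ½ * ε ≡ ε
  halves ε = trans (sym (ℚ.*-distribʳ-+ ε ½ ½)) (ℚ.*-identityˡ ε)

  cauchy-const : ∀ q → IsCauchy (λ _ → q)
  cauchy-const q ε 0<ε =
    0 , λ _ _ _ _ → subst (λ z → ∣ z ∣ < ε) (sym (ℚ.+-inverseʳ q)) 0<ε

  cauchy-+ : ∀ {s t} → IsCauchy s → IsCauchy t → IsCauchy (λ i → s i + t i)
  cauchy-+ {s} {t} cs ct ε 0<ε
    with cs (½ * ε) (half-pos 0<ε) | ct (½ * ε) (half-pos 0<ε)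
  ... | M , hM | N , hN = M ⊔ N , λ i j i≥ j≥ → begin-strict
    ∣ (s i + t i) - (s j + t j) ∣
      ≡⟨ cong ∣_∣ (lemma (s i) (t i) (s j) (t j)) ⟩
    ∣ (s i - s j) + (t i - t j) ∣
      ≤⟨ ℚ.∣p+q∣≤∣p∣+∣q∣ (s i - s j) (t i - t j) ⟩
    ∣ s i - s j ∣ + ∣ t i - t j ∣
      <⟨ ℚ.+-mono-< (hM i j (ℕ.m⊔n≤o⇒m≤o M N i≥) (ℕ.m⊔n≤o⇒m≤o M N j≥))
                    (hN i j (ℕ.m⊔n≤o⇒n≤o M N i≥) (ℕ.m⊔n≤o⇒n≤o M N j≥)) ⟩
    ½ * ε + ½ * ε ≡⟨ halves ε ⟩
    ε ∎
    where
    open ℚ.≤-Reasoning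
    lemma : ∀ a b c d → (a + b) - (c + d) ≡ (a - c) + (b - d)
    lemma = solve 4 (λ a b c d →
      ((a :+ b) :- (c :+ d)) := ((a :- c) :+ (b :- d))) refl
      where open +-*-Solver

  cauchy-neg : ∀ {s} → IsCauchy s → IsCauchy (λ i → - s i)
  cauchy-neg {s} cs ε 0<ε with cs ε 0<ε
  ... | N , h = N , λ i j i≥ j≥ →
    subst (_< ε)
      (trans (sym (ℚ.∣-p∣≡∣p∣ (s i - s j)))
             (cong ∣_∣ (ℚ.neg-distrib-+ (s i) (- s j))))
      (h i j i≥ j≥)

  ∣p∣≤∣q∣+∣p-q∣ : ∀ p q → ∣ p ∣ ≤ ∣ q ∣ + ∣ p - q ∣
  ∣p∣≤∣q∣+∣p-q∣ p q =
    subst (λ z → ∣ z ∣ ≤ ∣ q ∣ + ∣ p - q ∣) (lemma p q)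
      (ℚ.∣p+q∣≤∣p∣+∣q∣ q (p - q))
    where
    lemma : ∀ a b → b + (a - b) ≡ a
    lemma = solve 2 (λ a b → (b :+ (a :- b)) := a) refl
      where open +-*-Solver

  ∣p-q∣≡∣q-p∣ : ∀ p q → ∣ p - q ∣ ≡ ∣ q - p ∣
  ∣p-q∣≡∣q-p∣ p q =
    trans (sym (ℚ.∣-p∣≡∣p∣ (p - q))) (cong ∣_∣ (lemma p q))
    where
    lemma : ∀ a b → - (a - b) ≡ b - a
    lemma = solve 2 (λ a b → (:- (a :- b)) := (b :- a)) refl
      where open +-*-Solver

  cauchy-∣∣ : ∀ {s} → IsCauchy s → IsCauchy (λ i → ∣ s i ∣)
  cauchy-∣∣ {s} cs ε 0<ε with cs ε 0<ε
  ... | N , h = N , λ i j i≥ j≥ →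
    ℚ.≤-<-trans (reverse-triangle (s i) (s j)) (h i j i≥ j≥)
    where
    cancel : ∀ a b d → a ≤ b + d → a - b ≤ d
    cancel a b d a≤b+d =
      subst (a - b ≤_) (lemma b d) (ℚ.+-monoˡ-≤ (- b) a≤b+d)
      where
      lemma : ∀ b d → (b + d) - b ≡ d
      lemma = solve 2 (λ b d → ((b :+ d) :- b) := d) refl
        where open +-*-Solver
    reverse-triangle : ∀ p q → ∣ ∣ p ∣ - ∣ q ∣ ∣ ≤ ∣ p - q ∣
    reverse-triangle p q with ℚ.∣p∣≡p∨∣p∣≡-p (∣ p ∣ - ∣ q ∣)
    ... | inj₁ eq = subst (_≤ ∣ p - q ∣) (sym eq)
      (cancel ∣ p ∣ ∣ q ∣ _ (∣p∣≤∣q∣+∣p-q∣ p q))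
    ... | inj₂ eq = subst (_≤ ∣ p - q ∣) (sym (trans eq (lemma ∣ p ∣ ∣ q ∣)))
      (cancel ∣ q ∣ ∣ p ∣ _
        (subst (λ z → ∣ q ∣ ≤ ∣ p ∣ + z) (∣p-q∣≡∣q-p∣ q p) (∣p∣≤∣q∣+∣p-q∣ q p)))
      where
      lemma : ∀ a b → - (a - b) ≡ b - a
      lemma = solve 2 (λ a b → (:- (a :- b)) := (b :- a)) refl
        where open +-*-Solver

  EventuallyBounded : (ℕ → ℚ) → Set
  EventuallyBounded s =
    ∃[ B ] ∃[ N ] (0ℚ < B × (∀ i → N ℕ.≤ i → ∣ s i ∣ ≤ B))

  bounded : ∀ {s} → IsCauchy s → EventuallyBounded s
  bounded {s} cs with cs 1ℚ (ℚ.positive⁻¹ 1ℚ)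
  ... | N , h = ∣ s N ∣ + 1ℚ , N
    , ℚ.+-mono-≤-< (ℚ.0≤∣p∣ (s N)) (ℚ.positive⁻¹ 1ℚ)
    , λ i i≥ → ℚ.≤-trans (∣p∣≤∣q∣+∣p-q∣ (s i) (s N))
        (ℚ.+-monoʳ-≤ ∣ s N ∣ (ℚ.<⇒≤ (h i N i≥ ℕ.≤-refl)))

  divide : ∀ ε B → 0ℚ < ε → 0ℚ < B → ∃[ δ ] (0ℚ < δ × B * δ ≡ ε)
  divide ε B 0<ε 0<B = B⁻¹ * ε , δ-pos , eq
    where
    instance
      B-pos : Positive B
      B-pos = positive 0<B
      B-nz : NonZero B
      B-nz = ℚ.pos⇒nonZero B
    B⁻¹ : ℚ
    B⁻¹ = 1/ B
    instance
      B⁻¹-pos : Positive B⁻¹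
      B⁻¹-pos = ℚ.1/pos⇒pos B
    δ-pos : 0ℚ < B⁻¹ * ε
    δ-pos = subst (_< B⁻¹ * ε) (ℚ.*-zeroʳ B⁻¹) (ℚ.*-monoʳ-<-pos B⁻¹ 0<ε)
    eq : B * (B⁻¹ * ε) ≡ ε
    eq = trans (sym (ℚ.*-assoc B B⁻¹ ε))
      (trans (cong (_* ε) (ℚ.*-inverseʳ B)) (ℚ.*-identityˡ ε))

  abs-product : ∀ a b {B d} → 0ℚ < B → ∣ a ∣ ≤ B → ∣ b ∣ < d → ∣ a * b ∣ < B * d
  abs-product a b {B} {d} 0<B a≤B b<d = begin-strict
    ∣ a * b ∣      ≡⟨ ℚ.∣p*q∣≡∣p∣*∣q∣ a b ⟩
    ∣ a ∣ * ∣ b ∣  ≤⟨ ℚ.*-monoʳ-≤-nonNeg ∣ b ∣ {{ℚ.∣-∣-nonNeg b}} a≤B ⟩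
    B * ∣ b ∣      <⟨ ℚ.*-monoʳ-<-pos B {{positive 0<B}} b<d ⟩
    B * d          ∎
    where open ℚ.≤-Reasoning

  product-step : ∀ s s′ t t′ {B C δ η} → 0ℚ < B → 0ℚ < C →
    ∣ s ∣ ≤ B → ∣ t′ ∣ ≤ C → ∣ t - t′ ∣ < δ → ∣ s - s′ ∣ < η →
    ∣ s * t - s′ * t′ ∣ < B * δ + C * η
  product-step s s′ t t′ {B} {C} {δ} {η} 0<B 0<C s≤B t′≤C Δt Δs = begin-strict
    ∣ s * t - s′ * t′ ∣
      ≡⟨ cong ∣_∣ (lemma s t s′ t′) ⟩
    ∣ s * (t - t′) + t′ * (s - s′) ∣
      ≤⟨ ℚ.∣p+q∣≤∣p∣+∣q∣ (s * (t - t′)) (t′ * (s - s′)) ⟩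
    ∣ s * (t - t′) ∣ + ∣ t′ * (s - s′) ∣
      <⟨ ℚ.+-mono-< (abs-product s (t - t′) 0<B s≤B Δt)
                    (abs-product t′ (s - s′) 0<C t′≤C Δs) ⟩
    B * δ + C * η ∎
    where
    open ℚ.≤-Reasoning
    lemma : ∀ a b c d → a * b - c * d ≡ a * (b - d) + d * (a - c)
    lemma = solve 4 (λ a b c d →
      ((a :* b) :- (c :* d)) := ((a :* (b :- d)) :+ (d :* (a :- c)))) refl
      where open +-*-Solver

  cauchy-* : ∀ {s t} → IsCauchy s → IsCauchy t → IsCauchy (λ i → s i * t i)
  cauchy-* {s} {t} cs ct ε 0<ε = step₁ (bounded cs) (bounded ct)
    where
    Goal : Set
    Goal = ∃[ N ] (∀ i j → N ℕ.≤ i → N ℕ.≤ j → ∣ s i * t i - s j * t j ∣ < ε)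

    step₂ : ∀ B C K L δ η → 0ℚ < B → 0ℚ < C →
      (∀ i → K ℕ.≤ i → ∣ s i ∣ ≤ B) → (∀ i → L ℕ.≤ i → ∣ t i ∣ ≤ C) →
      B * δ ≡ ½ * ε → C * η ≡ ½ * ε →
      ∃[ M ] (∀ i j → M ℕ.≤ i → M ℕ.≤ j → ∣ t i - t j ∣ < δ) →
      ∃[ N ] (∀ i j → N ℕ.≤ i → N ℕ.≤ j → ∣ s i - s j ∣ < η) → Goal
    step₂ B C K L δ η 0<B 0<C hB hC Bδ Cη (M , hM) (N , hN) =
      (K ⊔ L) ⊔ (M ⊔ N) , λ i j i≥ j≥ →
        subst (∣ s i * t i - s j * t j ∣ <_)
          (trans (cong₂ _+_ Bδ Cη) (halves ε))
          (product-step (s i) (s j) (t i) (t j) 0<B 0<C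
            (hB i (K≤ i≥)) (hC j (L≤ j≥))
            (hM i j (M≤ i≥) (M≤ j≥)) (hN i j (N≤ i≥) (N≤ j≥)))
      where
      module _ {k} (k≥ : (K ⊔ L) ⊔ (M ⊔ N) ℕ.≤ k) where
        K≤ : K ℕ.≤ k
        K≤ = ℕ.m⊔n≤o⇒m≤o K L (ℕ.m⊔n≤o⇒m≤o (K ⊔ L) (M ⊔ N) k≥)
        L≤ : L ℕ.≤ k
        L≤ = ℕ.m⊔n≤o⇒n≤o K L (ℕ.m⊔n≤o⇒m≤o (K ⊔ L) (M ⊔ N) k≥)
        M≤ : M ℕ.≤ k
        M≤ = ℕ.m⊔n≤o⇒m≤o M N (ℕ.m⊔n≤o⇒n≤o (K ⊔ L) (M ⊔ N) k≥)
        N≤ : N ℕ.≤ k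
        N≤ = ℕ.m⊔n≤o⇒n≤o M N (ℕ.m⊔n≤o⇒n≤o (K ⊔ L) (M ⊔ N) k≥)

    step₁ : EventuallyBounded s → EventuallyBounded t → Goal
    step₁ (B , K , 0<B , hB) (C , L , 0<C , hC) =
      let δ , 0<δ , Bδ = divide (½ * ε) B (half-pos 0<ε) 0<B
          η , 0<η , Cη = divide (½ * ε) C (half-pos 0<ε) 0<C
      in step₂ B C K L δ η 0<B 0<C hB hC Bδ Cη (ct δ 0<δ) (cs η 0<η)

fromℚ : ℚ → ℝ
fromℚ q = mkℝ (λ _ → q) (cauchy-const q)

fromℕ : ℕ → ℝ
fromℕ n = fromℚ (ℤ.+ n / 1)

0ᵣ 1ᵣ : ℝ
0ᵣ = fromℚ 0ℚ
1ᵣ = fromℚ 1ℚ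

infixl 6 _+ᵣ_ _-ᵣ_
infixl 7 _*ᵣ_

_+ᵣ_ : ℝ → ℝ → ℝ
x +ᵣ y = mkℝ (λ i → seq x i + seq y i) (cauchy-+ {seq x} {seq y} (cauchy x) (cauchy y))

-ᵣ_ : ℝ → ℝ
-ᵣ x = mkℝ (λ i → - seq x i) (cauchy-neg {seq x} (cauchy x))

_-ᵣ_ : ℝ → ℝ → ℝ
x -ᵣ y = x +ᵣ (-ᵣ y)

_*ᵣ_ : ℝ → ℝ → ℝ
x *ᵣ y = mkℝ (λ i → seq x i * seq y i) (cauchy-* {seq x} {seq y} (cauchy x) (cauchy y))

∣_∣ᵣ : ℝ → ℝ
∣ x ∣ᵣ = mkℝ (λ i → ∣ seq x i ∣) (cauchy-∣∣ {seq x} (cauchy x))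

------------------------------------------------------------------------
-- Graphs

record Graph : Set₁ where
  field
    Vertex : Set
    order  : ℕ
    finite : Vertex ↔ Fin order
    Adj    : Rel Vertex 0ℓ
    adj?   : Decidable Adj
    symm   : Symmetric Adj
    irrefl : Irreflexive _≡_ Adj

module _ (G : Graph) where
  open Graph G

  nb : Vertex → Pred Vertex 0ℓ
  nb v w = Adj v w

  IsUNN : Set
  IsUNN = ∀ u v → u ≢ v → ¬ (nb u ≐ nb v)

  private
    all-vertices? : {P : Pred Vertex 0ℓ} → U.Decidable P → Dec (∀ v → P v)
    all-vertices? {P} P? =
      map′ (λ h v → subst P (Inverse.strictlyInverseʳ finite v) (h (Inverse.to finite v)))
           (λ h i → h (Inverse.from finite i))
           (all? (λ i → P? (Inverse.from finite i)))

    _≟_ : DecidableEquality Vertex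
    _≟_ = via-injection (Inverse⇒Injection finite) Fin._≟_

    nb-⊆? : ∀ u v → Dec (nb u U.⊆ nb v)
    nb-⊆? u v = map′ (λ h {w} → h w) (λ h w → h {w})
                  (all-vertices? (λ w → adj? u w →-dec adj? v w))

  isUNN? : Dec IsUNN
  isUNN? = all-vertices? λ u → all-vertices? λ v →
    ¬? (u ≟ v) →-dec ¬? (nb-⊆? u v ×-dec nb-⊆? v u)

------------------------------------------------------------------------
-- The random bipartite graph

-- Entry (i , k) says whether {i , k} is an edge, for i ∈ V₁ and k ∈ V₂.
Outcome : ℕ → ℕ → Set
Outcome n m = Vec (Vec Bool m) n

module _ {n m : ℕ} (ω : Outcome n m) where

  BipAdj : Rel (Fin n ⊎ Fin m) 0ℓ
  BipAdj (inj₁ i) (inj₂ k) = T (lookup (lookup ω i) k)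
  BipAdj (inj₂ k) (inj₁ i) = T (lookup (lookup ω i) k)
  BipAdj (inj₁ _) (inj₁ _) = ⊥
  BipAdj (inj₂ _) (inj₂ _) = ⊥

  private
    bipAdj? : Decidable BipAdj
    bipAdj? (inj₁ i) (inj₂ k) = T? _
    bipAdj? (inj₂ k) (inj₁ i) = T? _
    bipAdj? (inj₁ _) (inj₁ _) = no id
    bipAdj? (inj₂ _) (inj₂ _) = no id

    bip-symm : Symmetric BipAdj
    bip-symm {inj₁ _} {inj₂ _} e = e
    bip-symm {inj₂ _} {inj₁ _} e = e

    bip-irrefl : Irreflexive _≡_ BipAdj
    bip-irrefl {inj₁ _} refl ()
    bip-irrefl {inj₂ _} refl ()

  bipGraph : Graph
  bipGraph = record
    { Vertex = Fin n ⊎ Fin m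
    ; order  = n ℕ.+ m
    ; finite = ↔-sym +↔⊎
    ; Adj    = BipAdj
    ; adj?   = bipAdj?
    ; symm   = λ {u} {v} → bip-symm {u} {v}
    ; irrefl = bip-irrefl
    }

allVecs : {A : Set} → List A → ∀ n → List (Vec A n)
allVecs xs zero    = [] ∷ []
allVecs xs (suc n) = cartesianProductWith _∷_ xs (allVecs xs n)

-- Every element of Outcome n m, each listed exactly once.
outcomes : ∀ n m → List (Outcome n m)
outcomes n m = allVecs (allVecs (true ∷ false ∷ []) m) n

∑ : List ℝ → ℝ
∑ = foldr _+ᵣ_ 0ᵣ

∏ : ∀ {n} → Vec ℝ n → ℝ
∏ = Vec.foldr′ _*ᵣ_ 1ᵣ

bernoulli : ℝ → Bool → ℝ
bernoulli p b = if b then p else 1ᵣ -ᵣ p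

-- Independence of the edges: the weight of an outcome is the product of the
-- Bernoulli(p) weights of its n·m entries.
weight : ℝ → ∀ {n m} → Outcome n m → ℝ
weight p ω = ∏ (Vec.map (λ row → ∏ (Vec.map (bernoulli p) row)) ω)

Pr : ℝ → ∀ n m {P : Pred (Outcome n m) 0ℓ} → U.Decidable P → ℝ
Pr p n m P? = ∑ (map (weight p) (filter P? (outcomes n m)))

PrUNN : ℝ → ℕ → ℕ → ℝ
PrUNN p n m = Pr p n m (λ ω → isUNN? (bipGraph ω))

------------------------------------------------------------------------
-- Asymptotics along a set S of admissible pairs (n , m)

-- "Sufficiently large" refers to n + m, as in the limit n + m → ∞. Were it to
-- require n and m both large, pairs with n bounded and m → ∞ would be
-- unconstrained.
ThetaRelated : (ℕ → ℕ → Set) → Set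
ThetaRelated S = ∃[ a ] ∃[ b ] ∃[ N ]
  (0ᵣ <ᵣ a × 0ᵣ <ᵣ b ×
   (∀ n m → S n m → N ℕ.≤ n ℕ.+ m →
      fromℕ n ≤ᵣ a *ᵣ fromℕ m × fromℕ m ≤ᵣ b *ᵣ fromℕ n))

TendsTo : (ℕ → ℕ → Set) → (ℕ → ℕ → ℝ) → ℝ → Set
TendsTo S f ℓ = ∀ ε → 0ᵣ <ᵣ ε →
  ∃[ N ] (∀ n m → S n m → N ℕ.≤ n ℕ.+ m → ∣ f n m -ᵣ ℓ ∣ᵣ <ᵣ ε)

{-# OPTIONS --safe #-}

-- If G fails to be a UNN, then two rows of its biadjacency matrix coincide, or
-- two columns coincide, or some row vanishes: vertices on different sides can
-- only share the empty neighbourhood. If p and 1 - p are both at most c < 1,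
-- then n independent edges agree with n given values with probability at most cⁿ, so by
-- the union bound a failure has probability at most n² cᵐ + m² cⁿ + n cᵐ. When n
-- and m are comparable both tend to infinity with n + m, and k² cᵏ → 0.
-- All estimates are made in ℚ, on the terms of the Cauchy sequence for p.

module Submission where

open import Defs
open import Algebra.Bundles using (CommutativeRing)
open import Data.Bool using (Bool; true; false; T)
import Data.Bool.Properties as Bool
open import Data.Empty using (⊥-elim)
open import Data.Fin using (Fin; zero; suc)
import Data.Fin.Properties as Fin
open import Data.Integer as ℤ using (-[1+_])
import Data.Integer.Properties as ℤ
open import Data.List using (List; []; _∷_; _++_; map; foldr; filter; cartesianProductWith)
open import Data.Nat as ℕ using (ℕ; zero; suc)
import Data.Nat.Coprimality as ℕ
import Data.Nat.Properties as ℕ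
open import Data.Nat.Tactic.RingSolver using (solve-∀)
open import Data.Product using (∃-syntax; _×_; _,_; proj₁; proj₂)
open import Data.Rational
open import Data.Rational.Properties
open import Data.Rational.Solver using (module +-*-Solver)
open import Data.Sum using (_⊎_; inj₁; inj₂; [_,_]′)
open import Data.Unit using (tt)
open import Data.Vec as Vec using (Vec; []; _∷_; lookup; replicate)
import Data.Vec.Properties as Vec
open import Function using (_∘_; case_of_)
open import Level using (0ℓ)
open import Relation.Binary.PropositionalEquality
open import Relation.Nullary using (¬_; Dec; yes; no; ¬?; _×-dec_; _⊎-dec_)
open import Relation.Unary using (Pred; Decidable)

open import Algebra.Properties.Semiring.Exp (CommutativeRing.semiring +-*-commutativeRing) using (_^_)
open +-*-Solver using (solve; _:=_; _:+_; _:*_; _:-_; :-_; con)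
open ≤-Reasoning

private variable
  A B : Set

-- Products and powers in the ordered field ℚ

0≤1 : 0ℚ ≤ 1ℚ
0≤1 = *≤* (ℤ.+≤+ ℕ.z≤n)

*-monoʳ-≤ : ∀ {p q r} → 0ℚ ≤ r → p ≤ q → r * p ≤ r * q
*-monoʳ-≤ {r = r} 0≤r = *-monoˡ-≤-nonNeg r {{nonNegative 0≤r}}

*-monoˡ-≤ : ∀ {p q r} → 0ℚ ≤ r → p ≤ q → p * r ≤ q * r
*-monoˡ-≤ {r = r} 0≤r = *-monoʳ-≤-nonNeg r {{nonNegative 0≤r}}

*-mono-≤ : ∀ {p q r s} → 0ℚ ≤ p → 0ℚ ≤ s → p ≤ q → r ≤ s → p * r ≤ q * s
*-mono-≤ 0≤p 0≤s p≤q r≤s = ≤-trans (*-monoʳ-≤ 0≤p r≤s) (*-monoˡ-≤ 0≤s p≤q)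

0≤* : ∀ {p q} → 0ℚ ≤ p → 0ℚ ≤ q → 0ℚ ≤ p * q
0≤* {p} 0≤p 0≤q = ≤-trans (≤-reflexive (sym (*-zeroʳ p))) (*-monoʳ-≤ 0≤p 0≤q)

0<* : ∀ {p q} → 0ℚ < p → 0ℚ < q → 0ℚ < p * q
0<* {p} 0<p 0<q = ≤-<-trans (≤-reflexive (sym (*-zeroʳ p))) (*-monoʳ-<-pos p {{positive 0<p}} 0<q)

0≤^ : ∀ {p} n → 0ℚ ≤ p → 0ℚ ≤ p ^ n
0≤^ zero    0≤p = 0≤1
0≤^ (suc n) 0≤p = 0≤* 0≤p (0≤^ n 0≤p)

^≤1 : ∀ {p} n → 0ℚ ≤ p → p ≤ 1ℚ → p ^ n ≤ 1ℚ
^≤1 zero    0≤p p≤1 = ≤-refl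
^≤1 (suc n) 0≤p p≤1 = *-mono-≤ 0≤p 0≤1 p≤1 (^≤1 n 0≤p p≤1)

-- Natural numbers in ℚ

-- Opaque because unfolding ι n makes the type checker normalise the gcd inside _/_.
opaque
  ι : ℕ → ℚ
  ι n = ℤ.+ n / 1

  ι≡/1 : ∀ n → ι n ≡ ℤ.+ n / 1
  ι≡/1 n = refl

  ι-0 : ι 0 ≡ 0ℚ
  ι-0 = refl

  ι-1 : ι 1 ≡ 1ℚ
  ι-1 = refl

  ι-normal : ∀ n → ι n ≡ mkℚ (ℤ.+ n) 0 (ℕ.sym (ℕ.1-coprimeTo n))
  ι-normal n = normalize-coprime (ℕ.sym (ℕ.1-coprimeTo n))

  ι-homo-+ : ∀ m n → ι (m ℕ.+ n) ≡ ι m + ι n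
  ι-homo-+ m n rewrite ι-normal m | ι-normal n =
    /-cong (sym (cong₂ ℤ._+_ (ℤ.*-identityʳ (ℤ.+ m)) (ℤ.*-identityʳ (ℤ.+ n)))) refl

  ι-homo-* : ∀ m n → ι (m ℕ.* n) ≡ ι m * ι n
  ι-homo-* m n rewrite ι-normal m | ι-normal n = /-cong (ℤ.pos-* m n) refl

  ι-mono-≤ : ∀ {m n} → m ℕ.≤ n → ι m ≤ ι n
  ι-mono-≤ {m} {n} m≤n rewrite ι-normal m | ι-normal n =
    *≤* (ℤ.*-monoʳ-≤-nonNeg (ℤ.+ 1) (ℤ.+≤+ m≤n))

  ι-cancel-≤ : ∀ {m n} → ι m ≤ ι n → m ℕ.≤ n
  ι-cancel-≤ {m} {n} h rewrite ι-normal m | ι-normal n with h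
  ... | *≤* h′ = ℤ.drop‿+≤+ (subst₂ ℤ._≤_ (ℤ.*-identityʳ (ℤ.+ m)) (ℤ.*-identityʳ (ℤ.+ n)) h′)

  0≤ι : ∀ n → 0ℚ ≤ ι n
  0≤ι n = ι-mono-≤ {0} {n} ℕ.z≤n

  0<ι : ∀ n → 0ℚ < ι (suc n)
  0<ι n = <-≤-trans (positive⁻¹ 1ℚ) (ι-mono-≤ {1} {suc n} (ℕ.s≤s ℕ.z≤n))

  archimedean : ∀ q → ∃[ n ] q ≤ ι n
  archimedean (mkℚ (ℤ.+ n) d _) = n , ≤-trans
    (*≤* (ℤ.*-monoˡ-≤-nonNeg (ℤ.+ n) {ℤ.+ 1} {ℤ.+ suc d} (ℤ.+≤+ (ℕ.s≤s ℕ.z≤n))))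
    (≤-reflexive (sym (ι-normal n)))
  archimedean (mkℚ -[1+ n ] d _) = 0 , *≤* ℤ.-≤+

-- The multiple is a successor so that the factor `ι (suc n)` is positive and can later be
-- cancelled.
archimedean-* : ∀ {d} q → 0ℚ < d → ∃[ n ] q ≤ ι (suc n) * d
archimedean-* {d} q 0<d = n , (begin
  q                ≡⟨ *-identityʳ q ⟨
  q * 1ℚ           ≡⟨ cong (q *_) (*-inverseˡ d) ⟨
  q * (1/ d * d)   ≡⟨ *-assoc q (1/ d) d ⟨
  q * 1/ d * d     ≤⟨ *-monoˡ-≤ (<⇒≤ 0<d) (≤-trans q/d≤n (ι-mono-≤ (ℕ.n≤1+n n))) ⟩
  ι (suc n) * d    ∎)
  where
  instance
    d-nonZero : NonZero d
    d-nonZero = pos⇒nonZero d {{positive 0<d}}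
  n = proj₁ (archimedean (q * 1/ d))
  q/d≤n = proj₂ (archimedean (q * 1/ d))

-- Geometric decay

-- The binomial coefficient (d + k) over d.
pascal : ℕ → ℕ → ℕ
pascal zero    k       = 1
pascal (suc d) zero    = 1
pascal (suc d) (suc k) = pascal (suc d) k ℕ.+ pascal d (suc k)

-- C(d + k, d) cᵏ δᵈ⁺¹ is the probability of k failures before the (d + 1)-st success.
pascal-bound : ∀ {c δ} → 0ℚ ≤ c → 0ℚ ≤ δ → c + δ ≡ 1ℚ →
  ∀ d k → ι (pascal d k) * (c ^ k * δ ^ d) ≤ 1ℚ
pascal-bound {c} {δ} 0≤c 0≤δ c+δ≡1 = go
  where
  c≤1 : c ≤ 1ℚ
  c≤1 = ≤-trans (≤-reflexive (sym (+-identityʳ c))) (≤-trans (+-monoʳ-≤ c 0≤δ) (≤-reflexive c+δ≡1))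
  δ≤1 : δ ≤ 1ℚ
  δ≤1 = ≤-trans (≤-reflexive (sym (+-identityˡ δ))) (≤-trans (+-monoˡ-≤ δ 0≤c) (≤-reflexive c+δ≡1))
  base : ∀ d k → ι 1 * (c ^ k * δ ^ d) ≤ 1ℚ
  base d k = ≤-trans (≤-reflexive (trans (cong (_* (c ^ k * δ ^ d)) ι-1) (*-identityˡ _)))
    (*-mono-≤ (0≤^ k 0≤c) 0≤1 (^≤1 k 0≤c c≤1) (^≤1 d 0≤δ δ≤1))
  rearrange : ∀ a b c δ x y →
    (a + b) * ((c * x) * (δ * y)) ≡ c * (a * (x * (δ * y))) + δ * (b * ((c * x) * y))
  rearrange = solve 6 (λ a b c δ x y →
    ((a :+ b) :* ((c :* x) :* (δ :* y))) :=
    (c :* (a :* (x :* (δ :* y))) :+ δ :* (b :* ((c :* x) :* y)))) refl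
  go : ∀ d k → ι (pascal d k) * (c ^ k * δ ^ d) ≤ 1ℚ
  go zero    k       = base 0 k
  go (suc d) zero    = base (suc d) 0
  -- Pascal's rule turns the left side into the convex combination, with weights c and δ, of the
  -- instances at (d + 1, k) and (d, k + 1).
  go (suc d) (suc k) = begin
    ι (pascal (suc d) k ℕ.+ pascal d (suc k)) * (c ^ suc k * δ ^ suc d)
      ≡⟨ cong (_* (c ^ suc k * δ ^ suc d)) (ι-homo-+ (pascal (suc d) k) (pascal d (suc k))) ⟩
    (ι (pascal (suc d) k) + ι (pascal d (suc k))) * (c ^ suc k * δ ^ suc d)
      ≡⟨ rearrange (ι (pascal (suc d) k)) (ι (pascal d (suc k))) c δ (c ^ k) (δ ^ d) ⟩
    c * (ι (pascal (suc d) k) * (c ^ k * δ ^ suc d)) + δ * (ι (pascal d (suc k)) * (c ^ suc k * δ ^ d))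
      ≤⟨ +-mono-≤ (*-monoʳ-≤ 0≤c (go (suc d) k)) (*-monoʳ-≤ 0≤δ (go d (suc k))) ⟩
    c * 1ℚ + δ * 1ℚ
      ≡⟨ cong₂ _+_ (*-identityʳ c) (*-identityʳ δ) ⟩
    c + δ
      ≡⟨ c+δ≡1 ⟩
    1ℚ ∎

pascal-1 : ∀ k → pascal 1 k ≡ suc k
pascal-1 zero    = refl
pascal-1 (suc k) rewrite pascal-1 k = ℕ.+-comm (suc k) 1

pascal-2 : ∀ k → 2 ℕ.* pascal 2 k ≡ suc k ℕ.* (2 ℕ.+ k)
pascal-2 zero    = refl
pascal-2 (suc k) rewrite pascal-1 (suc k)
  | ℕ.*-distribˡ-+ 2 (pascal 2 k) (2 ℕ.+ k) | pascal-2 k = lemma k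
  where
  lemma : ∀ k → suc k ℕ.* (2 ℕ.+ k) ℕ.+ 2 ℕ.* (2 ℕ.+ k) ≡ suc (suc k) ℕ.* (2 ℕ.+ suc k)
  lemma = solve-∀

pascal-3 : ∀ k → 6 ℕ.* pascal 3 k ≡ suc k ℕ.* (2 ℕ.+ k) ℕ.* (3 ℕ.+ k)
pascal-3 zero    = refl
pascal-3 (suc k) rewrite ℕ.*-distribˡ-+ 6 (pascal 3 k) (pascal 2 (suc k)) | pascal-3 k
  | ℕ.*-assoc 3 2 (pascal 2 (suc k)) | pascal-2 (suc k) = lemma k
  where
  lemma : ∀ k → suc k ℕ.* (2 ℕ.+ k) ℕ.* (3 ℕ.+ k) ℕ.+ 3 ℕ.* (suc (suc k) ℕ.* (2 ℕ.+ suc k))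
    ≡ suc (suc k) ℕ.* (2 ℕ.+ suc k) ℕ.* (3 ℕ.+ suc k)
  lemma = solve-∀

-- Order 3 is one above the exponent in k² cᵏ; the spare factor k is what beats constants.
k³≤6*pascal-3 : ∀ k → k ℕ.* k ℕ.* k ℕ.≤ 6 ℕ.* pascal 3 k
k³≤6*pascal-3 k rewrite pascal-3 k =
  ℕ.*-mono-≤ (ℕ.*-mono-≤ (ℕ.m≤n+m k 1) (ℕ.m≤n+m k 2)) (ℕ.m≤n+m k 3)

-- The cubic binomial coefficient gives k³ cᵏ ≤ 6 / δ³. Hence M k² cᵏ ≤ 6 M / (δ³ k), and the
-- threshold makes the right side at most ε.
k²c^k-vanishes : ∀ {c δ} → 0ℚ ≤ c → 0ℚ < δ → c + δ ≡ 1ℚ → ∀ {ε} → 0ℚ < ε → ∀ M → 0ℚ ≤ M →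
  ∃[ N ] (∀ k → N ℕ.≤ k → M * (ι k * ι k * c ^ k) ≤ ε)
k²c^k-vanishes {c} {δ} 0≤c 0<δ c+δ≡1 {ε} 0<ε M 0≤M
  with archimedean-* (ι 6 * M) (0<* (0<* 0<δ (0<* 0<δ 0<δ)) 0<ε)
... | n , 6M≤n = suc n , bound
  where
  δ³ = δ * (δ * δ)
  0<δ³ : 0ℚ < δ³
  0<δ³ = 0<* 0<δ (0<* 0<δ 0<δ)

  bound : ∀ k → suc n ℕ.≤ k → M * (ι k * ι k * c ^ k) ≤ ε
  bound k n<k = *-cancelˡ-≤-pos (ι (suc n) * δ³) {{positive (0<* (0<ι n) 0<δ³)}} (begin
    ι (suc n) * δ³ * (M * (ι k * ι k * c ^ k))
      ≡⟨ solve 5 (λ n d M k x → n :* d :* (M :* (k :* k :* x)) := n :* (M :* (k :* k :* (x :* d))))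
           refl (ι (suc n)) δ³ M (ι k) (c ^ k) ⟩
    ι (suc n) * (M * (ι k * ι k * (c ^ k * δ³)))
      -- Since `suc n` is at most k, it can be traded for the third factor k.
      ≤⟨ *-monoˡ-≤ (0≤* 0≤M (0≤* (0≤* (0≤ι k) (0≤ι k)) 0≤x)) (ι-mono-≤ n<k) ⟩
    ι k * (M * (ι k * ι k * (c ^ k * δ³)))
      ≡⟨ solve 3 (λ M k x → k :* (M :* (k :* k :* x)) := M :* (k :* k :* k :* x)) refl M (ι k) (c ^ k * δ³) ⟩
    M * (ι k * ι k * ι k * (c ^ k * δ³))
      ≡⟨ cong (λ z → M * (z * (c ^ k * δ³))) (trans (cong (_* ι k) (sym (ι-homo-* k k))) (sym (ι-homo-* (k ℕ.* k) k))) ⟩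
    M * (ι (k ℕ.* k ℕ.* k) * (c ^ k * δ³))
      ≤⟨ *-monoʳ-≤ 0≤M (*-monoˡ-≤ 0≤x (ι-mono-≤ (k³≤6*pascal-3 k))) ⟩
    M * (ι (6 ℕ.* pascal 3 k) * (c ^ k * δ³))
      ≡⟨ cong (λ z → M * (z * (c ^ k * δ³))) (ι-homo-* 6 (pascal 3 k)) ⟩
    M * (ι 6 * ι (pascal 3 k) * (c ^ k * δ³))
      ≡⟨ cong (M *_) (*-assoc (ι 6) (ι (pascal 3 k)) (c ^ k * δ³)) ⟩
    M * (ι 6 * (ι (pascal 3 k) * (c ^ k * δ³)))
      ≡⟨ cong (λ z → M * (ι 6 * (ι (pascal 3 k) * (c ^ k * (δ * (δ * z)))))) (*-identityʳ δ) ⟨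
    M * (ι 6 * (ι (pascal 3 k) * (c ^ k * δ ^ 3)))
      ≤⟨ *-monoʳ-≤ 0≤M (*-monoʳ-≤ (0≤ι 6) (pascal-bound 0≤c (<⇒≤ 0<δ) c+δ≡1 3 k)) ⟩
    M * (ι 6 * 1ℚ)
      ≡⟨ cong (M *_) (*-identityʳ (ι 6)) ⟩
    M * ι 6
      ≡⟨ *-comm M (ι 6) ⟩
    ι 6 * M
      ≤⟨ 6M≤n ⟩
    ι (suc n) * (δ³ * ε)
      ≡⟨ *-assoc (ι (suc n)) δ³ ε ⟨
    ι (suc n) * δ³ * ε ∎)
    where
    0≤x : 0ℚ ≤ c ^ k * δ³
    0≤x = 0≤* (0≤^ k 0≤c) (<⇒≤ 0<δ³)

-- Finite probability distributions

sumOver : List A → (A → ℚ) → ℚ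
sumOver xs f = foldr (λ x s → f x + s) 0ℚ xs

sumOver-cong : ∀ (xs : List A) {f g} → (∀ x → f x ≡ g x) → sumOver xs f ≡ sumOver xs g
sumOver-cong []       f≗g = refl
sumOver-cong (x ∷ xs) f≗g = cong₂ _+_ (f≗g x) (sumOver-cong xs f≗g)

sumOver-mono-≤ : ∀ (xs : List A) {f g} → (∀ x → f x ≤ g x) → sumOver xs f ≤ sumOver xs g
sumOver-mono-≤ []       f≤g = ≤-refl
sumOver-mono-≤ (x ∷ xs) f≤g = +-mono-≤ (f≤g x) (sumOver-mono-≤ xs f≤g)

sumOver-+ : ∀ (xs : List A) f g → sumOver xs (λ x → f x + g x) ≡ sumOver xs f + sumOver xs g
sumOver-+ []       f g = refl
sumOver-+ (x ∷ xs) f g = trans (cong (f x + g x +_) (sumOver-+ xs f g))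
  (interchange (f x) (g x) (sumOver xs f) (sumOver xs g))
  where
  interchange : ∀ a b c d → a + b + (c + d) ≡ a + c + (b + d)
  interchange = solve 4 (λ a b c d → (a :+ b :+ (c :+ d)) := (a :+ c :+ (b :+ d))) refl

sumOver-*ˡ : ∀ (xs : List A) c f → sumOver xs (λ x → c * f x) ≡ c * sumOver xs f
sumOver-*ˡ []       c f = sym (*-zeroʳ c)
sumOver-*ˡ (x ∷ xs) c f = trans (cong (c * f x +_) (sumOver-*ˡ xs c f))
  (sym (*-distribˡ-+ c (f x) (sumOver xs f)))

sumOver-++ : ∀ (xs ys : List A) f → sumOver (xs ++ ys) f ≡ sumOver xs f + sumOver ys f
sumOver-++ []       ys f = sym (+-identityˡ _)
sumOver-++ (x ∷ xs) ys f = trans (cong (f x +_) (sumOver-++ xs ys f)) (sym (+-assoc (f x) _ _))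

sumOver-map : ∀ (h : A → B) xs f → sumOver (map h xs) f ≡ sumOver xs (f ∘ h)
sumOver-map h []       f = refl
sumOver-map h (x ∷ xs) f = cong (f (h x) +_) (sumOver-map h xs f)

sumOver-cartesianProductWith : ∀ {C : Set} (h : A → B → C) xs ys f →
  sumOver (cartesianProductWith h xs ys) f ≡ sumOver xs (λ x → sumOver ys (λ y → f (h x y)))
sumOver-cartesianProductWith h []       ys f = refl
sumOver-cartesianProductWith h (x ∷ xs) ys f =
  trans (sumOver-++ (map (h x) ys) (cartesianProductWith h xs ys) f)
    (cong₂ _+_ (sumOver-map (h x) ys f) (sumOver-cartesianProductWith h xs ys f))

record Distribution (A : Set) : Set where
  field
    points : List A
    mass   : A → ℚ
    0≤mass : ∀ x → 0ℚ ≤ mass x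
    total  : sumOver points mass ≡ 1ℚ

  𝔼 : (A → ℚ) → ℚ
  𝔼 f = sumOver points (λ x → mass x * f x)

  𝔼-mono-≤ : ∀ {f g} → (∀ x → f x ≤ g x) → 𝔼 f ≤ 𝔼 g
  𝔼-mono-≤ f≤g = sumOver-mono-≤ points (λ x → *-monoʳ-≤ (0≤mass x) (f≤g x))

  𝔼-+ : ∀ f g → 𝔼 (λ x → f x + g x) ≡ 𝔼 f + 𝔼 g
  𝔼-+ f g = trans (sumOver-cong points (λ x → *-distribˡ-+ (mass x) (f x) (g x)))
    (sumOver-+ points (λ x → mass x * f x) (λ x → mass x * g x))

  𝔼-*ʳ : ∀ f c → 𝔼 (λ x → f x * c) ≡ 𝔼 f * c
  𝔼-*ʳ f c = trans (sumOver-cong points (λ x → rotate (mass x) (f x) c))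
    (trans (sumOver-*ˡ points c (λ x → mass x * f x)) (*-comm c (𝔼 f)))
    where
    rotate : ∀ a b c → a * (b * c) ≡ c * (a * b)
    rotate = solve 3 (λ a b c → (a :* (b :* c)) := (c :* (a :* b))) refl

  𝔼-const : ∀ c → 𝔼 (λ _ → c) ≡ c
  𝔼-const c = trans (sumOver-cong points (λ x → *-comm (mass x) c))
    (trans (sumOver-*ˡ points c mass) (trans (cong (c *_) total) (*-identityʳ c)))

open Distribution

χ : Dec B → ℚ
χ (yes _) = 1ℚ
χ (no  _) = 0ℚ

0≤χ : (d : Dec B) → 0ℚ ≤ χ d
0≤χ (yes _) = 0≤1
0≤χ (no  _) = ≤-refl

χ≤1 : (d : Dec B) → χ d ≤ 1ℚ
χ≤1 (yes _) = ≤-refl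
χ≤1 (no  _) = 0≤1

χ-mono-≤ : {X Y : Set} (d : Dec X) (e : Dec Y) → (X → Y) → χ d ≤ χ e
χ-mono-≤ (yes x) (yes _) f = ≤-refl
χ-mono-≤ (yes x) (no ¬y) f = ⊥-elim (¬y (f x))
χ-mono-≤ (no  _) e       f = 0≤χ e

χ-∪ : {X Y Z : Set} (d : Dec X) (e : Dec Y) (e′ : Dec Z) → (X → Y ⊎ Z) → χ d ≤ χ e + χ e′
χ-∪ (no _)  e e′ f = +-mono-≤ (0≤χ e) (0≤χ e′)
χ-∪ (yes x) e e′ f with f x
... | inj₁ y = ≤-trans (χ-mono-≤ (yes x) e (λ _ → y)) (≤-trans (≤-reflexive (sym (+-identityʳ (χ e)))) (+-monoʳ-≤ (χ e) (0≤χ e′)))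
... | inj₂ z = ≤-trans (χ-mono-≤ (yes x) e′ (λ _ → z)) (≤-trans (≤-reflexive (sym (+-identityˡ (χ e′)))) (+-monoˡ-≤ (χ e′) (0≤χ e)))

module _ {A : Set} (D : Distribution A) where
  private variable
    P Q R : Pred A 0ℓ

  ℙ : Decidable P → ℚ
  ℙ P? = 𝔼 D (λ x → χ (P? x))

  ℙ-≤1 : (P? : Decidable P) → ℙ P? ≤ 1ℚ
  ℙ-≤1 P? = ≤-trans (𝔼-mono-≤ D (λ x → χ≤1 (P? x))) (≤-reflexive (𝔼-const D 1ℚ))

  ℙ-all : (P? : Decidable P) → (∀ x → P x) → 1ℚ ≤ ℙ P?
  ℙ-all P? all = ≤-trans (≤-reflexive (sym (𝔼-const D 1ℚ)))
    (𝔼-mono-≤ D (λ x → χ-mono-≤ (yes (all x)) (P? x) (λ p → p)))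

  ℙ-none : (P? : Decidable P) → (∀ x → ¬ P x) → ℙ P? ≤ 0ℚ
  ℙ-none P? none = ≤-trans
    (𝔼-mono-≤ D (λ x → χ-mono-≤ (P? x) (no (none x)) (λ p → p)))
    (≤-reflexive (𝔼-const D 0ℚ))

  ℙ-mono-≤ : (P? : Decidable P) (Q? : Decidable Q) → (∀ x → P x → Q x) → ℙ P? ≤ ℙ Q?
  ℙ-mono-≤ P? Q? P⊆Q = 𝔼-mono-≤ D (λ x → χ-mono-≤ (P? x) (Q? x) (P⊆Q x))

  ℙ-∪ : (R? : Decidable R) (P? : Decidable P) (Q? : Decidable Q) →
    (∀ x → R x → P x ⊎ Q x) → ℙ R? ≤ ℙ P? + ℙ Q?
  ℙ-∪ R? P? Q? R⊆P∪Q = ≤-trans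
    (𝔼-mono-≤ D (λ x → χ-∪ (R? x) (P? x) (Q? x) (R⊆P∪Q x)))
    (≤-reflexive (𝔼-+ D (χ ∘ P?) (χ ∘ Q?)))

  -- The union bound, by splitting off the first index.
  ℙ-∃ : ∀ {n b} {P : Fin n → Pred A 0ℓ} (P? : ∀ i → Decidable (P i)) →
    (∀ i → ℙ (P? i) ≤ b) → ℙ (λ x → Fin.any? (λ i → P? i x)) ≤ ι n * b
  ℙ-∃ {zero} {b} P? bound =
    ≤-trans (ℙ-none (λ x → Fin.any? (λ i → P? i x)) (λ _ ())) (≤-reflexive (trans (sym (*-zeroˡ b)) (cong (_* b) (sym ι-0))))
  ℙ-∃ {suc n} {b} P? bound = begin
    ℙ (λ x → Fin.any? (λ i → P? i x))
      ≤⟨ ℙ-∪ (λ x → Fin.any? (λ i → P? i x)) (P? zero) (λ x → Fin.any? (λ i → P? (suc i) x))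
           (λ { x (zero , p) → inj₁ p ; x (suc i , p) → inj₂ (i , p) }) ⟩
    ℙ (P? zero) + ℙ (λ x → Fin.any? (λ i → P? (suc i) x))
      ≤⟨ +-mono-≤ (bound zero) (ℙ-∃ (λ i → P? (suc i)) (λ i → bound (suc i))) ⟩
    b + ι n * b
      ≡⟨ cong (_+ ι n * b) (trans (sym (*-identityˡ b)) (cong (_* b) (sym ι-1))) ⟩
    ι 1 * b + ι n * b
      ≡⟨ *-distribʳ-+ b (ι 1) (ι n) ⟨
    (ι 1 + ι n) * b
      ≡⟨ cong (_* b) (ι-homo-+ 1 n) ⟨
    ι (suc n) * b ∎

-- Independent samples

vecMass : (A → ℚ) → ∀ {n} → Vec A n → ℚ
vecMass w []       = 1ℚ
vecMass w (x ∷ v)  = w x * vecMass w v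

-- Fubini for the first coordinate: its sum becomes the outer one. Every use of independence below
-- goes through this identity.
sumOver-allVecs : ∀ (xs : List A) w n (f : Vec A (suc n) → ℚ) →
  sumOver (allVecs xs (suc n)) (λ v → vecMass w v * f v) ≡
  sumOver xs (λ x → w x * sumOver (allVecs xs n) (λ v → vecMass w v * f (x ∷ v)))
sumOver-allVecs xs w n f = trans (sumOver-cartesianProductWith _∷_ xs (allVecs xs n) (λ v → vecMass w v * f v))
  (sumOver-cong xs λ x → trans
    (sumOver-cong (allVecs xs n) (λ v → *-assoc (w x) (vecMass w v) (f (x ∷ v))))
    (sumOver-*ˡ (allVecs xs n) (w x) (λ v → vecMass w v * f (x ∷ v))))

infixr 8 _^ᵈ_

_^ᵈ_ : Distribution A → ∀ n → Distribution (Vec A n)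
points (D ^ᵈ n) = allVecs (points D) n
mass   (D ^ᵈ n) = vecMass (mass D)
0≤mass (D ^ᵈ n) []      = 0≤1
0≤mass (D ^ᵈ (suc n)) (x ∷ v) = 0≤* (0≤mass D x) (0≤mass (D ^ᵈ n) v)
total  (D ^ᵈ zero)  = refl
total  (D ^ᵈ suc n) = trans (sumOver-cong (allVecs (points D) (suc n)) (λ v → sym (*-identityʳ (vecMass (mass D) v))))
  (trans (sumOver-allVecs (points D) (mass D) n (λ _ → 1ℚ))
  (trans (sumOver-cong (points D) (λ x → cong (mass D x *_) (𝔼-const (D ^ᵈ n) 1ℚ)))
  (𝔼-const D 1ℚ)))

module _ {A : Set} (D : Distribution A) where

  𝔼-∷ : ∀ n f → 𝔼 (D ^ᵈ suc n) f ≡ 𝔼 D (λ x → 𝔼 (D ^ᵈ n) (λ v → f (x ∷ v)))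
  𝔼-∷ = sumOver-allVecs (points D) (mass D)

  -- Conditioning on the first coordinate: a bound uniform in its value survives averaging.
  ℙ-∷-≤ : ∀ {n b} {R : Pred (Vec A (suc n)) 0ℓ} (R? : Decidable R) →
    (∀ x → ℙ (D ^ᵈ n) (λ v → R? (x ∷ v)) ≤ b) → ℙ (D ^ᵈ suc n) R? ≤ b
  ℙ-∷-≤ {n} {b} R? bound = begin
    ℙ (D ^ᵈ suc n) R?                          ≡⟨ 𝔼-∷ n (χ ∘ R?) ⟩
    𝔼 D (λ x → ℙ (D ^ᵈ n) (λ v → R? (x ∷ v)))  ≤⟨ 𝔼-mono-≤ D bound ⟩
    𝔼 D (λ x → b)                              ≡⟨ 𝔼-const D b ⟩
    b                                          ∎

  -- Given the first coordinate x, the event is empty unless `Q zero x` holds, and otherwise implies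
  -- the same kind of event for the remaining coordinates. As R need only imply the coordinatewise
  -- conditions, both a prescribed row and a pair of equal columns fit.
  ℙ-∀ : ∀ {n b} {Q : Fin n → Pred A 0ℓ} {R : Pred (Vec A n) 0ℓ} → 0ℚ ≤ b →
    (Q? : ∀ i → Decidable (Q i)) (R? : Decidable R) →
    (∀ v → R v → ∀ i → Q i (lookup v i)) →
    (∀ i → ℙ D (Q? i) ≤ b) → ℙ (D ^ᵈ n) R? ≤ b ^ n
  ℙ-∀ {zero}  0≤b Q? R? R⊆Q bound = ℙ-≤1 (D ^ᵈ 0) R?
  ℙ-∀ {suc n} {b} {Q} 0≤b Q? R? R⊆Q bound = begin
    ℙ (D ^ᵈ suc n) R?
      ≡⟨ 𝔼-∷ n (χ ∘ R?) ⟩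
    𝔼 D (λ x → ℙ (D ^ᵈ n) (λ v → R? (x ∷ v)))
      ≤⟨ 𝔼-mono-≤ D (λ x → step x (Q? zero x)) ⟩
    𝔼 D (λ x → χ (Q? zero x) * b ^ n)
      ≡⟨ 𝔼-*ʳ D (χ ∘ Q? zero) (b ^ n) ⟩
    ℙ D (Q? zero) * b ^ n
      ≤⟨ *-monoˡ-≤ (0≤^ n 0≤b) (bound zero) ⟩
    b * b ^ n ∎
    where
    -- The decision is an argument so that matching on it evaluates `χ d`.
    step : ∀ x (d : Dec (Q zero x)) → ℙ (D ^ᵈ n) (λ v → R? (x ∷ v)) ≤ χ d * b ^ n
    step x (yes _) = ≤-trans
      (ℙ-∀ 0≤b (λ i → Q? (suc i)) (λ v → R? (x ∷ v)) (λ v r i → R⊆Q (x ∷ v) r (suc i)) (λ i → bound (suc i)))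
      (≤-reflexive (sym (*-identityˡ (b ^ n))))
    step x (no ¬q) = ≤-trans
      (ℙ-none (D ^ᵈ n) (λ v → R? (x ∷ v)) (λ v r → ¬q (R⊆Q (x ∷ v) r zero)))
      (≤-reflexive (sym (*-zeroˡ (b ^ n))))

  -- Each coordinate has marginal distribution D: earlier coordinates are conditioned on, later ones
  -- average out.
  ℙ-lookup : ∀ {n b} {Q : Pred A 0ℓ} {R : Pred (Vec A n) 0ℓ}
    (Q? : Decidable Q) (R? : Decidable R) (i : Fin n) →
    (∀ v → R v → Q (lookup v i)) → ℙ D Q? ≤ b → ℙ (D ^ᵈ n) R? ≤ b
  ℙ-lookup {suc n} {b} Q? R? zero R⊆Q bound = begin
    ℙ (D ^ᵈ suc n) R?
      ≤⟨ ℙ-mono-≤ (D ^ᵈ suc n) R? (λ v → Q? (lookup v zero)) R⊆Q ⟩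
    ℙ (D ^ᵈ suc n) (λ v → Q? (lookup v zero))
      ≡⟨ 𝔼-∷ n (λ v → χ (Q? (lookup v zero))) ⟩
    𝔼 D (λ x → 𝔼 (D ^ᵈ n) (λ v → χ (Q? x)))
      ≤⟨ 𝔼-mono-≤ D (λ x → ≤-reflexive (𝔼-const (D ^ᵈ n) (χ (Q? x)))) ⟩
    ℙ D Q?
      ≤⟨ bound ⟩
    b ∎
  ℙ-lookup {suc n} Q? R? (suc i) R⊆Q bound =
    ℙ-∷-≤ R? (λ x → ℙ-lookup Q? (λ v → R? (x ∷ v)) i (λ v → R⊆Q (x ∷ v)) bound)

  -- Conditioned on the earlier of the two coordinates, the other must hit a prescribed value, and b
  -- bounds every atom of D. This serves both for two rows of the matrix and for two entries of one
  -- row.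
  ℙ-coincide : ∀ {n b} (_≟ₐ_ : (x y : A) → Dec (x ≡ y)) (i j : Fin n) → i ≢ j →
    {R : Pred (Vec A n) 0ℓ} (R? : Decidable R) →
    (∀ v → R v → lookup v i ≡ lookup v j) →
    (∀ a → ℙ D (_≟ₐ a) ≤ b) → ℙ (D ^ᵈ n) R? ≤ b
  ℙ-coincide _≟ₐ_ zero    zero    i≢j R? R⊆ bound = ⊥-elim (i≢j refl)
  ℙ-coincide _≟ₐ_ zero    (suc j) i≢j R? R⊆ bound = ℙ-∷-≤ R? λ x →
    ℙ-lookup (_≟ₐ x) (λ v → R? (x ∷ v)) j (λ v r → sym (R⊆ (x ∷ v) r)) (bound x)
  ℙ-coincide _≟ₐ_ (suc i) zero    i≢j R? R⊆ bound = ℙ-∷-≤ R? λ x →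
    ℙ-lookup (_≟ₐ x) (λ v → R? (x ∷ v)) i (λ v → R⊆ (x ∷ v)) (bound x)
  ℙ-coincide _≟ₐ_ (suc i) (suc j) i≢j R? R⊆ bound = ℙ-∷-≤ R? λ x →
    ℙ-coincide _≟ₐ_ i j (i≢j ∘ cong suc) (λ v → R? (x ∷ v)) (λ v → R⊆ (x ∷ v)) bound

-- Coincidences in the biadjacency matrix

lookup-ext : ∀ {n} {u v : Vec A n} → (∀ i → lookup u i ≡ lookup v i) → u ≡ v
lookup-ext {u = u} {v} eq =
  trans (sym (Vec.tabulate∘lookup u)) (trans (Vec.tabulate-cong eq) (Vec.tabulate∘lookup v))

T-ext : ∀ {a b} → (T a → T b) → (T b → T a) → a ≡ b
T-ext {true}  {true}  f g = refl
T-ext {false} {false} f g = refl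
T-ext {true}  {false} f g = ⊥-elim (f tt)
T-ext {false} {true}  f g = ⊥-elim (g tt)

infix 4 _≟ᵣ_
_≟ᵣ_ : ∀ {m} (u v : Vec Bool m) → Dec (u ≡ v)
_≟ᵣ_ = Vec.≡-dec Bool._≟_

module _ {n m : ℕ} where

  -- Distinctness belongs to the event, so that the union can range over all pairs of indices, the
  -- diagonal events being empty.
  RowsCoincide : Fin n → Fin n → Pred (Outcome n m) 0ℓ
  RowsCoincide i j ω = i ≢ j × lookup ω i ≡ lookup ω j

  ColumnsCoincide : Fin m → Fin m → Pred (Outcome n m) 0ℓ
  ColumnsCoincide k l ω = k ≢ l × ∀ i → lookup (lookup ω i) k ≡ lookup (lookup ω i) l

  ZeroRow : Fin n → Pred (Outcome n m) 0ℓ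
  ZeroRow i ω = lookup ω i ≡ replicate m false

  rowsCoincide? : ∀ i j → Decidable (RowsCoincide i j)
  rowsCoincide? i j ω = ¬? (i Fin.≟ j) ×-dec lookup ω i ≟ᵣ lookup ω j

  columnsCoincide? : ∀ k l → Decidable (ColumnsCoincide k l)
  columnsCoincide? k l ω = ¬? (k Fin.≟ l) ×-dec
    Fin.all? (λ i → lookup (lookup ω i) k Bool.≟ lookup (lookup ω i) l)

  zeroRow? : ∀ i → Decidable (ZeroRow i)
  zeroRow? i ω = lookup ω i ≟ᵣ replicate m false

  someRowsCoincide? : Decidable (λ ω → ∃[ i ] ∃[ j ] RowsCoincide i j ω)
  someRowsCoincide? ω = Fin.any? (λ i → Fin.any? (λ j → rowsCoincide? i j ω))

  someColumnsCoincide? : Decidable (λ ω → ∃[ k ] ∃[ l ] ColumnsCoincide k l ω)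
  someColumnsCoincide? ω = Fin.any? (λ k → Fin.any? (λ l → columnsCoincide? k l ω))

  someZeroRow? : Decidable (λ ω → ∃[ i ] ZeroRow i ω)
  someZeroRow? ω = Fin.any? (λ i → zeroRow? i ω)

  UNN? : Decidable (λ (ω : Outcome n m) → IsUNN (bipGraph ω))
  UNN? ω = isUNN? (bipGraph ω)

  noCoincidence⇒UNN : ∀ ω →
    ¬ (∃[ i ] ∃[ j ] RowsCoincide i j ω) → ¬ (∃[ k ] ∃[ l ] ColumnsCoincide k l ω) →
    ¬ (∃[ i ] ZeroRow i ω) → IsUNN (bipGraph ω)
  noCoincidence⇒UNN ω ¬rows ¬cols ¬zero = unn
    where
    -- If i ∈ V₁ and k ∈ V₂ have the same neighbourhood, it is empty.
    mixed : ∀ i k → (∀ l → nb (bipGraph ω) (inj₁ i) (inj₂ l) → nb (bipGraph ω) (inj₂ k) (inj₂ l)) →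
      ZeroRow i ω
    mixed i k ⊆ = lookup-ext λ l →
      -- Adjacency within V₂ is ⊥, which is `T false` by computation.
      trans (T-ext {lookup (lookup ω i) l} {false} (⊆ l) (λ ())) (sym (Vec.lookup-replicate l false))
    unn : IsUNN (bipGraph ω)
    unn (inj₁ i) (inj₁ j) i≢j (⊆ , ⊇) = ¬rows (i , j , i≢j ∘ cong inj₁ ,
      lookup-ext (λ k → T-ext (⊆ {inj₂ k}) (⊇ {inj₂ k})))
    unn (inj₂ k) (inj₂ l) k≢l (⊆ , ⊇) = ¬cols (k , l , k≢l ∘ cong inj₂ ,
      λ i → T-ext (⊆ {inj₁ i}) (⊇ {inj₁ i}))
    unn (inj₁ i) (inj₂ k) _ (⊆ , ⊇) = ¬zero (i , mixed i k (λ l → ⊆ {inj₂ l}))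
    unn (inj₂ k) (inj₁ i) _ (⊆ , ⊇) = ¬zero (i , mixed i k (λ l → ⊇ {inj₂ l}))

  -- Decidability of the coincidences allows the case distinction. The result is a cover of the
  -- whole sample space, ready for the union bound.
  UNN-or-coincidence : ∀ ω → IsUNN (bipGraph ω) ⊎
    (∃[ i ] ∃[ j ] RowsCoincide i j ω) ⊎ (∃[ k ] ∃[ l ] ColumnsCoincide k l ω) ⊎ (∃[ i ] ZeroRow i ω)
  UNN-or-coincidence ω with someRowsCoincide? ω | someColumnsCoincide? ω | someZeroRow? ω
  ... | yes rows | _        | _        = inj₂ (inj₁ rows)
  ... | no _     | yes cols | _        = inj₂ (inj₂ (inj₁ cols))
  ... | no _     | no _     | yes z    = inj₂ (inj₂ (inj₂ z))
  ... | no ¬rows | no ¬cols | no ¬zero = inj₁ (noCoincidence⇒UNN ω ¬rows ¬cols ¬zero)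

-- The union bound for the random bipartite graph

failureBound : ℚ → ℕ → ℕ → ℚ
failureBound c n m = ι n * (ι n * c ^ m) + (ι m * (ι m * c ^ n) + ι n * c ^ m)

bernoulliᵈ : ∀ r → 0ℚ ≤ r → 0ℚ ≤ 1ℚ - r → Distribution Bool
points (bernoulliᵈ r _ _)         = true ∷ false ∷ []
mass   (bernoulliᵈ r _ _) true    = r
mass   (bernoulliᵈ r _ _) false   = 1ℚ - r
0≤mass (bernoulliᵈ r 0≤r _) true  = 0≤r
0≤mass (bernoulliᵈ r _ 0≤s) false = 0≤s
total  (bernoulliᵈ r _ _)         = solve 1 (λ r → r :+ (con 1ℚ :- r :+ con 0ℚ) := con 1ℚ) refl r

module _ {r c} (0≤r : 0ℚ ≤ r) (0≤1-r : 0ℚ ≤ 1ℚ - r) (r≤c : r ≤ c) (1-r≤c : 1ℚ - r ≤ c) where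

  edge : Distribution Bool
  edge = bernoulliᵈ r 0≤r 0≤1-r

  private
    0≤c : 0ℚ ≤ c
    0≤c = ≤-trans 0≤r r≤c

  edge-atom : ∀ b → ℙ edge (Bool._≟ b) ≤ c
  edge-atom true  = ≤-trans (≤-reflexive (solve 1 (λ r →
    r :* con 1ℚ :+ ((con 1ℚ :- r) :* con 0ℚ :+ con 0ℚ) := r) refl r)) r≤c
  edge-atom false = ≤-trans (≤-reflexive (solve 1 (λ r →
    r :* con 0ℚ :+ ((con 1ℚ :- r) :* con 1ℚ :+ con 0ℚ) := (con 1ℚ :- r)) refl r)) 1-r≤c

  -- Independent rows of independent edges. Its `points` compute to `outcomes n m`, so it can be
  -- compared with `Pr` term by term.
  randomGraph : ∀ n m → Distribution (Outcome n m)
  randomGraph n m = (edge ^ᵈ m) ^ᵈ n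

  row-atom : ∀ {m} (u : Vec Bool m) → ℙ (edge ^ᵈ m) (_≟ᵣ u) ≤ c ^ m
  row-atom u = ℙ-∀ edge 0≤c (λ i → Bool._≟ lookup u i) (_≟ᵣ u)
    (λ v v≡u i → cong (λ w → lookup w i) v≡u) (λ i → edge-atom (lookup u i))

  module _ (n m : ℕ) where

    private
      G = randomGraph n m

    -- Distinct rows are independent samples of `edge ^ᵈ m`, whose atoms have mass at most cᵐ.
    ℙ-rowsCoincide : ∀ i j → ℙ G (rowsCoincide? i j) ≤ c ^ m
    ℙ-rowsCoincide i j = case i Fin.≟ j of λ where
      (yes i≡j) → ≤-trans (ℙ-none G (rowsCoincide? i j) (λ ω (i≢j , _) → i≢j i≡j)) (0≤^ m 0≤c)
      (no i≢j)  → ℙ-coincide (edge ^ᵈ m) _≟ᵣ_ i j i≢j (rowsCoincide? i j) (λ ω → proj₂) row-atom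

    -- Columns are not samples of the outer product, so their equality is read row by row: in each
    -- of the n independent rows the entries k and l agree with probability at most c.
    ℙ-columnsCoincide : ∀ k l → ℙ G (columnsCoincide? k l) ≤ c ^ n
    ℙ-columnsCoincide k l = case k Fin.≟ l of λ where
      (yes k≡l) → ≤-trans (ℙ-none G (columnsCoincide? k l) (λ ω (k≢l , _) → k≢l k≡l)) (0≤^ n 0≤c)
      (no k≢l)  → ℙ-∀ (edge ^ᵈ m) {n} 0≤c (λ i → same?) (columnsCoincide? k l) (λ ω → proj₂)
        (λ i → ℙ-coincide edge Bool._≟_ k l k≢l same? (λ v eq → eq) edge-atom)
     where
      same? : Decidable (λ (row : Vec Bool m) → lookup row k ≡ lookup row l)
      same? row = lookup row k Bool.≟ lookup row l

    ℙ-zeroRow : ∀ i → ℙ G (zeroRow? i) ≤ c ^ m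
    ℙ-zeroRow i = ℙ-lookup (edge ^ᵈ m) (_≟ᵣ replicate m false)
      (zeroRow? i) i (λ ω z → z) (row-atom (replicate m false))

    -- The additive form avoids complementary events: the sure event is covered by UNN and the
    -- coincidences.
    ℙ-UNN : 1ℚ ≤ ℙ G UNN? + failureBound c n m
    ℙ-UNN = begin
      1ℚ
        ≤⟨ ℙ-all G (λ _ → yes tt) (λ _ → tt) ⟩
      ℙ G (λ _ → yes tt)
        ≤⟨ ℙ-∪ G (λ _ → yes tt) UNN? R∪C∪Z? (λ ω _ → UNN-or-coincidence ω) ⟩
      ℙ G UNN? + ℙ G R∪C∪Z?
        ≤⟨ +-monoʳ-≤ (ℙ G UNN?) (ℙ-∪ G R∪C∪Z? someRowsCoincide? C∪Z? (λ _ x → x)) ⟩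
      ℙ G UNN? + (ℙ G someRowsCoincide? + ℙ G C∪Z?)
        -- For pairs `ℙ-∃` is applied once per index, whence the nested products in `failureBound`.
        ≤⟨ +-monoʳ-≤ (ℙ G UNN?) (+-mono-≤
             (ℙ-∃ G (λ i ω → Fin.any? (λ j → rowsCoincide? i j ω)) (λ i → ℙ-∃ G (rowsCoincide? i) (ℙ-rowsCoincide i)))
             (≤-trans (ℙ-∪ G C∪Z? someColumnsCoincide? someZeroRow? (λ _ x → x)) (+-mono-≤
               (ℙ-∃ G (λ k ω → Fin.any? (λ l → columnsCoincide? k l ω)) (λ k → ℙ-∃ G (columnsCoincide? k) (ℙ-columnsCoincide k)))
               (ℙ-∃ G zeroRow? ℙ-zeroRow)))) ⟩
      ℙ G UNN? + failureBound c n m ∎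
      where
      C∪Z? : Decidable _
      C∪Z? ω = someColumnsCoincide? ω ⊎-dec someZeroRow? ω
      R∪C∪Z? : Decidable _
      R∪C∪Z? ω = someRowsCoincide? ω ⊎-dec C∪Z? ω

-- The termwise arithmetic of ℝ

seq-∑ : ∀ (f : A → ℝ) xs i → seq (∑ (map f xs)) i ≡ sumOver xs (λ x → seq (f x) i)
seq-∑ f []       i = refl
seq-∑ f (x ∷ xs) i = cong (seq (f x) i +_) (seq-∑ f xs i)

seq-∏ : ∀ (f : A → ℝ) w i → (∀ x → seq (f x) i ≡ w x) →
  ∀ {n} (v : Vec A n) → seq (∏ (Vec.map f v)) i ≡ vecMass w v
seq-∏ f w i eq []      = refl
seq-∏ f w i eq (x ∷ v) = cong₂ _*_ (eq x) (seq-∏ f w i eq v)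

sumOver-filter : {P : Pred A 0ℓ} (P? : Decidable P) (xs : List A) (f : A → ℚ) →
  sumOver (filter P? xs) f ≡ sumOver xs (λ x → f x * χ (P? x))
sumOver-filter P? []       f = refl
sumOver-filter P? (x ∷ xs) f with P? x
... | yes _ = cong₂ _+_ (sym (*-identityʳ (f x))) (sumOver-filter P? xs f)
... | no  _ = trans (sumOver-filter P? xs f)
  (trans (sym (+-identityˡ _)) (cong (_+ sumOver xs (λ y → f y * χ (P? y))) (sym (*-zeroʳ (f x)))))

module _ (p : ℝ) (i : ℕ) {c} (0≤r : 0ℚ ≤ seq p i) (0≤1-r : 0ℚ ≤ 1ℚ - seq p i)
  (r≤c : seq p i ≤ c) (1-r≤c : 1ℚ - seq p i ≤ c) where

  -- A probability is a polynomial in p and ℝ computes termwise, so the i-th term is the rational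
  -- probability for the edge parameter `seq p i`.
  seq-Pr : ∀ n m {P : Pred (Outcome n m) 0ℓ} (P? : Decidable P) →
    seq (Pr p n m P?) i ≡ ℙ (randomGraph 0≤r 0≤1-r r≤c 1-r≤c n m) P?
  seq-Pr n m P? = trans (seq-∑ (weight p) (filter P? (outcomes n m)) i)
    (trans (sumOver-filter P? (outcomes n m) (λ ω → seq (weight p ω) i))
    (sumOver-cong (outcomes n m) (λ ω → cong (_* χ (P? ω)) (seq-weight ω))))
    where
    E = edge 0≤r 0≤1-r r≤c 1-r≤c
    seq-bernoulli : ∀ b → seq (bernoulli p b) i ≡ mass E b
    seq-bernoulli true  = refl
    seq-bernoulli false = refl
    seq-weight : (ω : Outcome n m) → seq (weight p ω) i ≡ vecMass (vecMass (mass E)) ω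
    seq-weight = seq-∏ _ _ i (seq-∏ (bernoulli p) (mass E) i seq-bernoulli)

-- Differences and absolute values in ℚ

p+q≤r⇒p≤r-q : ∀ {p r} q → p + q ≤ r → p ≤ r - q
p+q≤r⇒p≤r-q {p} {r} q h = ≤-trans
  (≤-reflexive (solve 2 (λ p q → p := (p :+ q :- q)) refl p q)) (+-monoˡ-≤ (- q) h)

p≤q+r⇒p-q≤r : ∀ {p} q {r} → p ≤ q + r → p - q ≤ r
p≤q+r⇒p-q≤r q {r} h = ≤-trans (+-monoˡ-≤ (- q) h)
  (≤-reflexive (solve 2 (λ q r → (q :+ r :- q) := r) refl q r))

p-q≤r⇒p≤q+r : ∀ p q {r} → p - q ≤ r → p ≤ q + r
p-q≤r⇒p≤q+r p q {r} h = ≤-trans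
  (≤-reflexive (solve 2 (λ p q → p := (q :+ (p :- q))) refl p q)) (+-monoʳ-≤ q h)

p≤∣p∣ : ∀ p → p ≤ ∣ p ∣
p≤∣p∣ p with ∣p∣≡p∨∣p∣≡-p p
... | inj₁ eq = ≤-reflexive (sym eq)
... | inj₂ eq = ≤-trans p≤0 (0≤∣p∣ p)
  where
  p≤0 : p ≤ 0ℚ
  p≤0 = ≤-trans (≤-reflexive (solve 1 (λ p → p := (:- (:- p))) refl p))
    (neg-antimono-≤ (≤-trans (0≤∣p∣ p) (≤-reflexive eq)))

∣p∣≤ : ∀ {p q} → p ≤ q → - p ≤ q → ∣ p ∣ ≤ q
∣p∣≤ {p} p≤q -p≤q with ∣p∣≡p∨∣p∣≡-p p
... | inj₁ eq = ≤-trans (≤-reflexive eq) p≤q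
... | inj₂ eq = ≤-trans (≤-reflexive eq) -p≤q

-- Comparable sizes and the decay of the failure bound

≤ᵣ-multiple : (a : ℝ) → ∃[ K ] (∀ n m → 0 ℕ.< m → fromℕ n ≤ᵣ a *ᵣ fromℕ m → n ℕ.≤ K ℕ.* m)
≤ᵣ-multiple a with cauchy a 1ℚ (positive⁻¹ 1ℚ)
... | N , close with archimedean (seq a N + 1ℚ)
-- The additional multiple of m absorbs the slack 1 that `≤ᵣ` leaves, as m is positive.
... | A , aN+1≤A = suc A , bound
  where
  bound : ∀ n m → 0 ℕ.< m → fromℕ n ≤ᵣ a *ᵣ fromℕ m → n ℕ.≤ suc A ℕ.* m
  bound n m 0<m n≤am with n≤am 1ℚ (positive⁻¹ 1ℚ)
  ... | M , h = ℕ.≤-trans (ι-cancel-≤ (begin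
    ι n                           ≡⟨ ι≡/1 n ⟩
    seq (fromℕ n) i               ≤⟨ h i (ℕ.m≤n⊔m N M) ⟩
    seq a i * seq (fromℕ m) i + 1ℚ ≡⟨ cong₂ (λ x y → seq a i * x + y) (ι≡/1 m) ι-1 ⟨
    seq a i * ι m + ι 1           ≤⟨ +-monoˡ-≤ (ι 1) (*-monoˡ-≤ (0≤ι m) (≤-trans aᵢ≤ aN+1≤A)) ⟩
    ι A * ι m + ι 1               ≡⟨ cong (_+ ι 1) (ι-homo-* A m) ⟨
    ι (A ℕ.* m) + ι 1             ≡⟨ ι-homo-+ (A ℕ.* m) 1 ⟨
    ι (A ℕ.* m ℕ.+ 1)             ∎))
    (ℕ.≤-trans (ℕ.+-monoʳ-≤ (A ℕ.* m) 0<m) (ℕ.≤-reflexive (ℕ.+-comm (A ℕ.* m) m)))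
    where
    -- M varies with n and m, but A bounds all terms of `a` from N on, so the multiple is uniform.
    i = N ℕ.⊔ M
    aᵢ≤ : seq a i ≤ seq a N + 1ℚ
    aᵢ≤ = p-q≤r⇒p≤q+r (seq a i) (seq a N)
      (≤-trans (p≤∣p∣ _) (<⇒≤ (close i N (ℕ.m≤m⊔n N M) ℕ.≤-refl)))

-- The second factor k is kept separate: it equals the first for pairs of rows or columns, and 1 for
-- zero rows.
quadratic-≤ : ∀ {n m k x} K → 0ℚ ≤ x → n ℕ.≤ K ℕ.* m → k ℕ.≤ K ℕ.* m →
  ι n * (ι k * x) ≤ ι (K ℕ.* K) * (ι m * ι m * x)
quadratic-≤ {n} {m} {k} {x} K 0≤x n≤Km k≤Km = begin
  ι n * (ι k * x)
    ≤⟨ *-mono-≤ (0≤ι n) (0≤* (0≤ι (K ℕ.* m)) 0≤x) (ι-mono-≤ n≤Km) (*-monoˡ-≤ 0≤x (ι-mono-≤ k≤Km)) ⟩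
  ι (K ℕ.* m) * (ι (K ℕ.* m) * x)
    ≡⟨ cong (λ y → y * (y * x)) (ι-homo-* K m) ⟩
  ι K * ι m * (ι K * ι m * x)
    ≡⟨ solve 3 (λ K m x → K :* m :* (K :* m :* x) := K :* K :* (m :* m :* x)) refl (ι K) (ι m) x ⟩
  ι K * ι K * (ι m * ι m * x)
    ≡⟨ cong (_* (ι m * ι m * x)) (ι-homo-* K K) ⟨
  ι (K ℕ.* K) * (ι m * ι m * x) ∎

failureBound-≤ : ∀ {c} → 0ℚ ≤ c → ∀ K n m → 0 ℕ.< n → n ℕ.≤ K ℕ.* m → m ℕ.≤ K ℕ.* n → ∀ {ε} →
  ι (K ℕ.* K) * (ι m * ι m * c ^ m) ≤ ε → ι (K ℕ.* K) * (ι n * ι n * c ^ n) ≤ ε →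
  failureBound c n m ≤ ε + (ε + ε)
failureBound-≤ {c} 0≤c K n m 0<n n≤Km m≤Kn {ε} m-small n-small = begin
  ι n * (ι n * c ^ m) + (ι m * (ι m * c ^ n) + ι n * c ^ m)
    ≡⟨ cong (λ x → ι n * (ι n * c ^ m) + (ι m * (ι m * c ^ n) + ι n * x))
         (trans (cong (_* c ^ m) ι-1) (*-identityˡ (c ^ m))) ⟨
  ι n * (ι n * c ^ m) + (ι m * (ι m * c ^ n) + ι n * (ι 1 * c ^ m))
    ≤⟨ +-mono-≤ (quadratic-≤ K (0≤^ m 0≤c) n≤Km n≤Km)
         (+-mono-≤ (quadratic-≤ K (0≤^ n 0≤c) m≤Kn m≤Kn)
                   -- The linear term is treated as a quadratic one, using 1 ≤ n ≤ K m.
                   (quadratic-≤ K (0≤^ m 0≤c) n≤Km (ℕ.≤-trans 0<n n≤Km))) ⟩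
  ι (K ℕ.* K) * (ι m * ι m * c ^ m) +
    (ι (K ℕ.* K) * (ι n * ι n * c ^ n) + ι (K ℕ.* K) * (ι m * ι m * c ^ m))
    ≤⟨ +-mono-≤ m-small (+-mono-≤ n-small m-small) ⟩
  ε + (ε + ε) ∎

⅓ : ℚ
⅓ = ℤ.+ 1 / 3

thirds : ∀ ε → ⅓ * ε + (⅓ * ε + ⅓ * ε) ≡ ε
thirds = solve 1 (λ ε → con ⅓ :* ε :+ (con ⅓ :* ε :+ con ⅓ :* ε) := ε) refl

-- Both sizes grow with their sum: (K + 1) N ≤ n + m ≤ (K + 1) m forces N ≤ m, and symmetrically N ≤
-- n. Each of the three summands then receives a third of ε.
failureBound-vanishes : ∀ {c δ} → 0ℚ ≤ c → 0ℚ < δ → c + δ ≡ 1ℚ → ∀ K {ε} → 0ℚ < ε →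
  ∃[ N ] (∀ n m → 0 ℕ.< n → n ℕ.≤ K ℕ.* m → m ℕ.≤ K ℕ.* n → N ℕ.≤ n ℕ.+ m → failureBound c n m ≤ ε)
failureBound-vanishes {c} 0≤c 0<δ c+δ≡1 K {ε} 0<ε = suc K ℕ.* N , λ n m 0<n n≤Km m≤Kn N≤n+m → ≤-trans
  (failureBound-≤ 0≤c K n m 0<n n≤Km m≤Kn
    (small m (large n m n≤Km N≤n+m))
    (small n (large m n m≤Kn (ℕ.≤-trans N≤n+m (ℕ.≤-reflexive (ℕ.+-comm n m))))))
  (≤-reflexive (thirds ε))
  where
  vanishing : ∃[ N ] (∀ k → N ℕ.≤ k → ι (K ℕ.* K) * (ι k * ι k * c ^ k) ≤ ⅓ * ε)
  vanishing = k²c^k-vanishes 0≤c 0<δ c+δ≡1 (0<* (positive⁻¹ ⅓) 0<ε) (ι (K ℕ.* K)) (0≤ι (K ℕ.* K))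
  N = proj₁ vanishing
  small = proj₂ vanishing
  large : ∀ n m → n ℕ.≤ K ℕ.* m → suc K ℕ.* N ℕ.≤ n ℕ.+ m → N ℕ.≤ m
  large n m n≤Km N≤n+m = ℕ.*-cancelˡ-≤ (suc K) (ℕ.≤-trans N≤n+m
    (ℕ.≤-trans (ℕ.+-monoˡ-≤ m n≤Km) (ℕ.≤-reflexive (ℕ.+-comm (K ℕ.* m) m))))

distance-≤ : ∀ {x y} → x ≤ 1ℚ → 1ℚ ≤ x + y → 0ℚ ≤ y → ∣ x - 1ℚ ∣ ≤ y
distance-≤ {x} {y} x≤1 1≤x+y 0≤y = ∣p∣≤
  (p≤q+r⇒p-q≤r 1ℚ (≤-trans x≤1 (≤-trans (≤-reflexive (sym (+-identityʳ 1ℚ))) (+-monoʳ-≤ 1ℚ 0≤y))))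
  (≤-trans (≤-reflexive (solve 1 (λ x → :- (x :- con 1ℚ) := (con 1ℚ :- x)) refl x)) (p≤q+r⇒p-q≤r x 1≤x+y))

-- Convergence to 1 along the admissible pairs

mainTheorem1 : (p : ℝ) → 0ᵣ <ᵣ p → p <ᵣ 1ᵣ →
    (S : ℕ → ℕ → Set) → (∀ n m → S n m → 0 ℕ.< n × 0 ℕ.< m) →
    ThetaRelated S →
    TendsTo S (PrUNN p) 1ᵣ
mainTheorem1 p (δ₁ , N₁ , 0<δ₁ , δ₁≤p) (δ₂ , N₂ , 0<δ₂ , p+δ₂≤1) S S-pos
  (a , b , N₀ , _ , _ , related) ε (η , N₃ , 0<η , η≤ε) = N₀ ℕ.⊔ N₄ , close
  where
  δ c ½η : ℚ
  -- For large indices δ₁ keeps the terms of p away from 0 and δ₂ keeps them away from 1. So c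
  -- bounds both r and 1 - r, uniformly in the index.
  δ = δ₁ ⊓ δ₂
  c = 1ℚ - δ
  -- One half of η bounds the distance to 1; the other is the positive gap that `<ᵣ` demands.
  ½η = ½ * η

  0<δ : 0ℚ < δ
  0<δ = [ (λ eq → <-≤-trans 0<δ₁ (≤-reflexive (sym eq))) , (λ eq → <-≤-trans 0<δ₂ (≤-reflexive (sym eq))) ]′ (⊓-sel δ₁ δ₂)

  0<½η : 0ℚ < ½η
  0<½η = 0<* (positive⁻¹ ½) 0<η

  module Large (i : ℕ) (N≤i : N₁ ℕ.⊔ N₂ ℕ.≤ i) where
    r : ℚ
    r = seq p i
    δ₁≤r : δ₁ ≤ r
    δ₁≤r = ≤-trans (≤-reflexive (sym (+-identityˡ δ₁))) (δ₁≤p i (ℕ.m⊔n≤o⇒m≤o N₁ N₂ N≤i))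
    r+δ₂≤1 : r + δ₂ ≤ 1ℚ
    r+δ₂≤1 = p+δ₂≤1 i (ℕ.m⊔n≤o⇒n≤o N₁ N₂ N≤i)
    0≤r : 0ℚ ≤ r
    0≤r = ≤-trans (<⇒≤ 0<δ₁) δ₁≤r
    r≤c : r ≤ c
    r≤c = p+q≤r⇒p≤r-q δ (≤-trans (+-monoʳ-≤ r (p⊓q≤q δ₁ δ₂)) r+δ₂≤1)
    1-r≤c : 1ℚ - r ≤ c
    1-r≤c = +-monoʳ-≤ 1ℚ (neg-antimono-≤ (≤-trans (p⊓q≤p δ₁ δ₂) δ₁≤r))
    0≤1-r : 0ℚ ≤ 1ℚ - r
    0≤1-r = p+q≤r⇒p≤r-q r (≤-trans (≤-reflexive (+-comm 0ℚ r))
      (≤-trans (+-monoʳ-≤ r (<⇒≤ 0<δ₂)) r+δ₂≤1))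

  c≥0 : 0ℚ ≤ c
  -- Any sufficiently late term r of p witnesses 0 ≤ r ≤ c.
  c≥0 = ≤-trans (Large.0≤r (N₁ ℕ.⊔ N₂) ℕ.≤-refl) (Large.r≤c (N₁ ℕ.⊔ N₂) ℕ.≤-refl)

  c+δ≡1 : c + δ ≡ 1ℚ
  c+δ≡1 = solve 1 (λ δ → con 1ℚ :- δ :+ δ := con 1ℚ) refl δ

  Ka Kb K : ℕ
  Ka = proj₁ (≤ᵣ-multiple a)
  Kb = proj₁ (≤ᵣ-multiple b)
  K = Ka ℕ.⊔ Kb

  vanishes = failureBound-vanishes c≥0 0<δ c+δ≡1 K 0<½η
  N₄ = proj₁ vanishes

  close : ∀ n m → S n m → N₀ ℕ.⊔ N₄ ℕ.≤ n ℕ.+ m → ∣ PrUNN p n m -ᵣ 1ᵣ ∣ᵣ <ᵣ ε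
  close n m s N≤n+m = ½η , (N₁ ℕ.⊔ N₂) ℕ.⊔ N₃ , 0<½η , λ i N≤i → begin
    ∣ seq (PrUNN p n m) i - 1ℚ ∣ + ½η
      ≤⟨ +-monoˡ-≤ ½η (near i (ℕ.m⊔n≤o⇒m≤o (N₁ ℕ.⊔ N₂) N₃ N≤i)) ⟩
    ½η + ½η
      ≡⟨ solve 1 (λ η → con ½ :* η :+ con ½ :* η := con 0ℚ :+ η) refl η ⟩
    0ℚ + η
      ≤⟨ η≤ε i (ℕ.m⊔n≤o⇒n≤o (N₁ ℕ.⊔ N₂) N₃ N≤i) ⟩
    seq ε i ∎
    where
    0<n = proj₁ (S-pos n m s)
    0<m = proj₂ (S-pos n m s)
    comparable = related n m s (ℕ.m⊔n≤o⇒m≤o N₀ N₄ N≤n+m)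
    n≤Km : n ℕ.≤ K ℕ.* m
    n≤Km = ℕ.≤-trans (proj₂ (≤ᵣ-multiple a) n m 0<m (proj₁ comparable)) (ℕ.*-monoˡ-≤ m (ℕ.m≤m⊔n Ka Kb))
    m≤Kn : m ℕ.≤ K ℕ.* n
    m≤Kn = ℕ.≤-trans (proj₂ (≤ᵣ-multiple b) m n 0<n (proj₂ comparable)) (ℕ.*-monoˡ-≤ n (ℕ.m≤n⊔m Ka Kb))

    near : ∀ i → N₁ ℕ.⊔ N₂ ℕ.≤ i → ∣ seq (PrUNN p n m) i - 1ℚ ∣ ≤ ½η
    near i N≤i = subst (λ x → ∣ x - 1ℚ ∣ ≤ ½η) (sym (seq-Pr p i 0≤r 0≤1-r r≤c 1-r≤c n m UNN?))
      (distance-≤ (ℙ-≤1 G UNN?)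
        (≤-trans (ℙ-UNN 0≤r 0≤1-r r≤c 1-r≤c n m) (+-monoʳ-≤ (ℙ G UNN?)
          (proj₂ vanishes n m 0<n n≤Km m≤Kn (ℕ.m⊔n≤o⇒n≤o N₀ N₄ N≤n+m))))
        (<⇒≤ 0<½η))
      where
      open Large i N≤i
      G = randomGraph 0≤r 0≤1-r r≤c 1-r≤c n m
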